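{- Let $G=(V,E)$ be a graph with maximum degree $\Delta$, let $n=|V|$, and let $k$ be a positive integer. Suppose we are given a legal $(k+1)$-coloring $c:V\to[k+1]$ of $G$ such that $|V_{c,k+1}|\le |V_{c,i}|$ holds for every $i\in[k+1]$. Then one can generate, in $O(n\Delta)$ time, a $k$-coloring $c'\in\mathcal{R}(c)$ such that $$\rho_k(c')\le\frac{n\Delta}{k(k+1)}.$$
   Context: Graphs are finite, simple and undirected; an edge $\{u,v\}$ is written $uv$. For a positive integer $n$, $[n]=\{1,\dots,n\}$. A $k$-coloring of $G=(V,E)$ is a mapping $c:V\to[k]$ (it uses at most $k$ colors, so not every color has to be used). An edge $uv\in E$ is conflicting in $c$ if $c(u)=c(v)$; the coloring $c$ is legal if it has no conflicting edge. For a color $i$, the color class $i$ is $V_{c,i}=\{v\in V : c(v)=i\}$. The set of all $k$-colorings of $G$ (legal or not) is denoted $\mathcal{S}_k$. The penalty function $\rho_k$ on $\mathcal{S}_k$ is the number of conflicting edges: $\rho_k(c)=|\{uv\in E : c(u)=c(v)\}|$. For a legal $(k+1)$-coloring $c$, $\mathcal{R}(c)$ is the set of all $k$-colorings obtained from $c$ by changing the colors of the vertices in $V_{c,k+1}$ to colors in $[k]$ (all other vertices keeping their colors), that is, $$\mathcal{R}(c)=\{c'\in\mathcal{S}_k : \forall i\in[k],\ V_{c',i}\supseteq V_{c,i},\ V_{c',i}\setminus V_{c,i}\subseteq V_{c,k+1}\}.$$ The statement asserts the existence of a deterministic algorithm which, on input $G$, $k$ and $c$, outputs such a $c'$; running time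 is counted in the usual way as the number of elementary operations. -}

module Defs where

open import Data.Bool using (Bool; true; false; if_then_else_)
open import Data.Fin using (Fin; toℕ; fromℕ; inject₁; _<?_)
import Data.Fin as Fin
open import Data.Fin.Subset using (Subset; ∣_∣; _⊆_; _─_)
open import Data.List using (List; allFin; cartesianProduct; filter; length; lookup; map)
open import Data.List.Extrema.Nat using (max)
open import Data.List.Membership.Propositional using (_∈_)
open import Data.List.Relation.Unary.Unique.Propositional using (Unique)
open import Data.Nat using (ℕ; suc; _+_; _∸_; _≡ᵇ_; _<ᵇ_)
open import Data.Product using (_×_; _,_)
open import Data.Vec using (tabulate)
open import Function.Bundles using (_⇔_)
open import Relation.Binary.PropositionalEquality using (_≡_; _≢_; refl; trans; sym)
open import Relation.Nullary using (¬_; Dec; does)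
open import Relation.Nullary.Decidable using (_×-dec_)

------------------------------------------------------------------------
-- Graphs and colorings

record Graph (n : ℕ) : Set₁ where
  infix 4 _~_ _~?_
  field
    _~_      : Fin n → Fin n → Set
    _~?_     : ∀ u v → Dec (u ~ v)
    ~-sym    : ∀ {u v} → u ~ v → v ~ u
    ~-irrefl : ∀ {v} → ¬ (v ~ v)

module _ {n : ℕ} (G : Graph n) where
  open Graph G

  neighbourhood : Fin n → Subset n
  neighbourhood v = tabulate λ u → does (v ~? u)

  degree : Fin n → ℕ
  degree v = ∣ neighbourhood v ∣

  -- The graph without vertices gets maximum degree 0.
  maxDegree : ℕ
  maxDegree = max 0 (map degree (allFin n))

  -- Each edge {u,v} is listed once, as the pair with u < v.
  edges : List (Fin n × Fin n)
  edges = filter (λ (u , v) → (u <? v) ×-dec (u ~? v))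
                 (cartesianProduct (allFin n) (allFin n))

-- The color i ∈ [k] of the mathematical convention is the element i - 1 of
-- Fin k.  Hence color k+1 is fromℕ k : Fin (suc k), and [k] ⊆ [k+1] is inject₁.
Coloring : ℕ → ℕ → Set
Coloring n k = Fin n → Fin k

module _ {n k : ℕ} where

  Legal : Graph n → Coloring n k → Set
  Legal G c = ∀ {u v} → u ~ v → c u ≢ c v
    where open Graph G

  colorClass : Coloring n k → Fin k → Subset n
  colorClass c i = tabulate λ v → does (c v Fin.≟ i)

  ρ : Graph n → Coloring n k → ℕ
  ρ G c = length (filter (λ (u , v) → c u Fin.≟ c v) (edges G))

infix 4 _∈𝓡_

_∈𝓡_ : ∀ {n k} → Coloring n k → Coloring n (suc k) → Set
_∈𝓡_ {k = k} c′ c = ∀ (i : Fin k) →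
  (colorClass c (inject₁ i) ⊆ colorClass c′ i) ×
  (colorClass c′ i ─ colorClass c (inject₁ i) ⊆ colorClass c (fromℕ k))

------------------------------------------------------------------------
-- Random access machine with unit costs, presented as a structured language.
-- A program mentions finitely many variables and arrays, each named by a
-- number; cells hold natural numbers.  Addition and truncated subtraction are
-- the only arithmetic, as in the usual unit-cost model: multiplication at unit
-- cost would allow numbers of exponential length in polynomial time.

infix  8 _[_]
infixl 7 _⊕_ _⊖_
infix  6 _≐_ _≺_

data Exp : Set where
  lit     : ℕ → Exp
  var     : ℕ → Exp
  _[_]    : ℕ → Exp → Exp
  _⊕_ _⊖_ : Exp → Exp → Exp

data Test : Set where
  _≐_ _≺_ : Exp → Exp → Test

infix  5 _≔_ _[_]≔_
infixr 4 _⨾_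

data Program : Set where
  skip   : Program
  _≔_    : ℕ → Exp → Program
  _[_]≔_ : ℕ → Exp → Exp → Program
  _⨾_    : Program → Program → Program
  cond   : Test → Program → Program → Program
  while  : Test → Program → Program

record State : Set where
  constructor ⟪_,_⟫
  field
    vars : ℕ → ℕ
    arrs : ℕ → ℕ → ℕ
open State public

update : {A : Set} → (ℕ → A) → ℕ → A → ℕ → A
update f x a y = if y ≡ᵇ x then a else f y

setVar : ℕ → ℕ → State → State
setVar x m ⟪ f , g ⟫ = ⟪ update f x m , g ⟫

setCell : ℕ → ℕ → ℕ → State → State
setCell a i m ⟪ f , g ⟫ = ⟪ f , update g a (update (g a) i m) ⟫

eval : Exp → State → ℕ
eval (lit m)   s = m
eval (var x)   s = vars s x
eval (a [ e ]) s = arrs s a (eval e s)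
eval (d ⊕ e)   s = eval d s + eval e s
eval (d ⊖ e)   s = eval d s ∸ eval e s

test : Test → State → Bool
test (d ≐ e) s = eval d s ≡ᵇ eval e s
test (d ≺ e) s = eval d s <ᵇ eval e s

-- One unit for every constant, memory access, arithmetic operation and
-- comparison.
cost : Exp → ℕ
cost (lit m)   = 1
cost (var x)   = 1
cost (a [ e ]) = suc (cost e)
cost (d ⊕ e)   = suc (cost d + cost e)
cost (d ⊖ e)   = suc (cost d + cost e)

testCost : Test → ℕ
testCost (d ≐ e) = suc (cost d + cost e)
testCost (d ≺ e) = suc (cost d + cost e)

infix 3 ⟨_,_⟩⇓⟨_,_⟩

-- ⟨ P , s ⟩⇓⟨ s′ , t ⟩: started in s, the program P halts in s′ after exactly
-- t elementary operations.
data ⟨_,_⟩⇓⟨_,_⟩ : Program → State → State → ℕ → Set where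
  ⇓-skip : ∀ {s} → ⟨ skip , s ⟩⇓⟨ s , 1 ⟩
  ⇓-assign : ∀ {x e s} →
    ⟨ x ≔ e , s ⟩⇓⟨ setVar x (eval e s) s , suc (cost e) ⟩
  ⇓-store : ∀ {a d e s} →
    ⟨ a [ d ]≔ e , s ⟩⇓⟨ setCell a (eval d s) (eval e s) s , suc (cost d + cost e) ⟩
  ⇓-seq : ∀ {P Q s s₁ s₂ t₁ t₂} →
    ⟨ P , s ⟩⇓⟨ s₁ , t₁ ⟩ → ⟨ Q , s₁ ⟩⇓⟨ s₂ , t₂ ⟩ →
    ⟨ P ⨾ Q , s ⟩⇓⟨ s₂ , t₁ + t₂ ⟩
  ⇓-then : ∀ {b P Q s s₁ t₁} → test b s ≡ true →
    ⟨ P , s ⟩⇓⟨ s₁ , t₁ ⟩ → ⟨ cond b P Q , s ⟩⇓⟨ s₁ , testCost b + t₁ ⟩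
  ⇓-else : ∀ {b P Q s s₁ t₁} → test b s ≡ false →
    ⟨ Q , s ⟩⇓⟨ s₁ , t₁ ⟩ → ⟨ cond b P Q , s ⟩⇓⟨ s₁ , testCost b + t₁ ⟩
  ⇓-done : ∀ {b P s} → test b s ≡ false →
    ⟨ while b P , s ⟩⇓⟨ s , testCost b ⟩
  ⇓-loop : ∀ {b P s s₁ s₂ t₁ t₂} → test b s ≡ true →
    ⟨ P , s ⟩⇓⟨ s₁ , t₁ ⟩ → ⟨ while b P , s₁ ⟩⇓⟨ s₂ , t₂ ⟩ →
    ⟨ while b P , s ⟩⇓⟨ s₂ , testCost b + (t₁ + t₂) ⟩

⇓-deterministic : ∀ {P s s₁ s₂ t₁ t₂} →
  ⟨ P , s ⟩⇓⟨ s₁ , t₁ ⟩ → ⟨ P , s ⟩⇓⟨ s₂ , t₂ ⟩ → s₁ ≡ s₂ × t₁ ≡ t₂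
⇓-deterministic ⇓-skip ⇓-skip = refl , refl
⇓-deterministic ⇓-assign ⇓-assign = refl , refl
⇓-deterministic ⇓-store ⇓-store = refl , refl
⇓-deterministic (⇓-seq p q) (⇓-seq p′ q′) with ⇓-deterministic p p′
... | refl , refl with ⇓-deterministic q q′
... | refl , refl = refl , refl
⇓-deterministic (⇓-then _ p) (⇓-then _ p′) with ⇓-deterministic p p′
... | refl , refl = refl , refl
⇓-deterministic (⇓-then h _) (⇓-else h′ _) with () ← trans (sym h) h′
⇓-deterministic (⇓-else h _) (⇓-then h′ _) with () ← trans (sym h) h′
⇓-deterministic (⇓-else _ p) (⇓-else _ p′) with ⇓-deterministic p p′
... | refl , refl = refl , refl
⇓-deterministic (⇓-done _) (⇓-done _) = refl , refl
⇓-deterministic (⇓-done h) (⇓-loop h′ _ _) with () ← trans (sym h) h′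
⇓-deterministic (⇓-loop h _ _) (⇓-done h′) with () ← trans (sym h) h′
⇓-deterministic (⇓-loop _ p q) (⇓-loop _ p′ q′) with ⇓-deterministic p p′
... | refl , refl with ⇓-deterministic q q′
... | refl , refl = refl , refl

------------------------------------------------------------------------
-- Input and output conventions

orderVar colorsVar : ℕ
orderVar  = 0
colorsVar = 1

startArr adjArr colorArr : ℕ
startArr = 0
adjArr   = 1
colorArr = 2

StoresColoring : ∀ {n k} → Coloring n k → State → Set
StoresColoring c s = ∀ v → arrs s colorArr (toℕ v) ≡ toℕ (c v)

-- The graph is given by adjacency lists in an arbitrary order, stored one after
-- the other: the list of v occupies the cells of adjArr from position start[v]
-- (inclusive) to start[v+1] (exclusive).  The maximum degree is not part of the
-- input, and memory not holding input may have any contents.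
record Input {n k : ℕ} (G : Graph n) (c : Coloring n (suc k)) (s : State) : Set where
  open Graph G
  field
    order    : vars s orderVar ≡ n
    colors   : vars s colorsVar ≡ k
    coloring : StoresColoring c s
    adj      : Fin n → List (Fin n)
    adj-unique   : ∀ v → Unique (adj v)
    adj-complete : ∀ {u v} → (u ∈ adj v) ⇔ (v ~ u)
    start    : ∀ v → arrs s startArr (suc (toℕ v)) ≡ arrs s startArr (toℕ v) + length (adj v)
    entry    : ∀ v (j : Fin (length (adj v))) →
               arrs s adjArr (arrs s startArr (toℕ v) + toℕ j) ≡ toℕ (lookup (adj v) j)

{-# OPTIONS --safe #-}

-- Move the whole class k+1 onto the color b ∈ [k] that minimizes the number
-- cut(b) of edges between the classes k+1 and b.  As class k+1 is independent,
-- the conflicting edges are exactly these, so k · ρ ≤ Σ cut(i) ≤ |V_{k+1}| Δ,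
-- and (k + 1) |V_{k+1}| ≤ n because class k+1 is a smallest one.
-- If V_{k+1} is nonempty then k < n, hence n counters suffice.

module Submission where

open import Defs
open import Data.Bool using (Bool; true; false; if_then_else_)
open import Data.Bool.Properties using (T-≡)
open import Data.Fin using (Fin; zero; suc; toℕ; fromℕ; fromℕ<; inject₁)
import Data.Fin as Fin
import Data.Fin.Properties as Fin
open import Data.Fin.Subset using (∣_∣; _∈_; _∉_; _─_)
open import Data.Fin.Subset.Properties using (p─q⊆p)
import Data.Integer as ℤ
import Data.Integer.Properties as ℤ
open import Data.List using (List; []; _∷_; length; filter; lookup; allFin; cartesianProduct; map)
import Data.List as List
import Data.List.Properties as List
open import Data.List.Extrema.Nat using (xs≤max)
open import Data.List.Membership.Propositional using () renaming (_∈_ to _∈ˡ_)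
open import Data.List.Membership.Propositional.Properties using (∈-map⁺; ∈-allFin; ∈-lookup)
import Data.List.Relation.Unary.All as All
open import Data.List.Relation.Unary.AllPairs using ([]; _∷_)
open import Data.List.Relation.Unary.Any using (index)
open import Data.List.Relation.Unary.Any.Properties using (lookup-index)
open import Data.List.Relation.Unary.Unique.Propositional using (Unique)
open import Data.Nat
open import Data.Nat.Properties
open import Data.Nat.Solver using (module +-*-Solver)
open import Data.Product using (_×_; _,_; ∃-syntax; proj₁; proj₂)
import Data.Rational as ℚ
import Data.Rational.Properties as ℚ
import Data.Rational.Unnormalised as ℚᵘ
import Data.Rational.Unnormalised.Properties as ℚᵘ
open import Data.Vec using (tabulate)
import Data.Vec as Vec
import Data.Vec.Properties as Vec
open import Function using (_∘_; Equivalence; _⇔_)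
open import Level using (Level)
open import Relation.Binary.PropositionalEquality hiding ([_])
open import Relation.Nullary using (Dec; does; yes; no; contradiction)
open import Relation.Nullary.Decidable using (dec-true; _×-dec_)
open import Relation.Unary using (Pred; Decidable)

open import Algebra.Properties.Semiring.Sum +-*-semiring
  using (sum; sum-syntax; sum-cong-≗; ∑-comm; ∑-distrib-+; *-distribˡ-sum)

private variable
  ℓ p q : Level
  A B : Set ℓ
  k m n : ℕ

-- The memory may hold anything, so counters have to be cleared, and clearing all `k` of them would
-- take time that `n` and the maximum degree do not bound. Hence every pass makes `n` rounds. For
-- `k > n` the selected color has no minimality property; the bound then holds because every cut is
-- 0. The program tallies edges through positions in adjacency lists, whereas `ρ` counts pairs
-- `u < v` of vertices. Both are written as sums over `Fin` of 0/1 indicators, which turns each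
-- double count into an exchange of two sums. The indicators compare natural numbers with `≡ᵇ`, the
-- test that the machine performs, so that the same terms serve in the loop invariants.

𝟙 : Bool → ℕ
𝟙 b = if b then 1 else 0

-- Boolean comparisons of natural numbers

≡ᵇ-true : ∀ {x y} → x ≡ y → (x ≡ᵇ y) ≡ true
≡ᵇ-true {x} {y} x≡y = Equivalence.to T-≡ (≡⇒≡ᵇ x y x≡y)

≡ᵇ-false : ∀ {x y} → x ≢ y → (x ≡ᵇ y) ≡ false
≡ᵇ-false {x} {y} x≢y with x ≡ᵇ y in eq
... | true  = contradiction (≡ᵇ⇒≡ x y (Equivalence.from T-≡ eq)) x≢y
... | false = refl

≡ᵇ-true⁻¹ : ∀ {x y} → (x ≡ᵇ y) ≡ true → x ≡ y
≡ᵇ-true⁻¹ {x} {y} eq = ≡ᵇ⇒≡ x y (Equivalence.from T-≡ eq)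

<ᵇ-true : ∀ {x y} → x < y → (x <ᵇ y) ≡ true
<ᵇ-true x<y = Equivalence.to T-≡ (<⇒<ᵇ x<y)

<ᵇ-false : ∀ {x y} → y ≤ x → (x <ᵇ y) ≡ false
<ᵇ-false {x} {y} y≤x with x <ᵇ y in eq
... | true  = contradiction (<ᵇ⇒< x y (Equivalence.from T-≡ eq)) (≤⇒≯ y≤x)
... | false = refl

<ᵇ-true⁻¹ : ∀ {x y} → (x <ᵇ y) ≡ true → x < y
<ᵇ-true⁻¹ {x} {y} eq = <ᵇ⇒< x y (Equivalence.from T-≡ eq)

<ᵇ-false⁻¹ : ∀ {x y} → (x <ᵇ y) ≡ false → y ≤ x
<ᵇ-false⁻¹ eq = ≮⇒≥ λ x<y → contradiction (trans (sym (<ᵇ-true x<y)) eq) λ ()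

-- Finite sums

sum-mono-≤ : {f g : Fin n → ℕ} → (∀ i → f i ≤ g i) → sum f ≤ sum g
sum-mono-≤ {zero}  f≤g = z≤n
sum-mono-≤ {suc n} f≤g = +-mono-≤ (f≤g zero) (sum-mono-≤ (f≤g ∘ suc))

sum-const : ∀ n a → ∑[ i < n ] a ≡ n * a
sum-const zero    a = refl
sum-const (suc n) a = cong (a +_) (sum-const n a)

sum-zero : (f : Fin n → ℕ) → (∀ i → f i ≡ 0) → sum f ≡ 0
sum-zero {zero}  f f≡0 = refl
sum-zero {suc n} f f≡0 = cong₂ _+_ (f≡0 zero) (sum-zero (f ∘ suc) (f≡0 ∘ suc))

term≤sum : ∀ (f : Fin n → ℕ) i → f i ≤ sum f
term≤sum f zero    = m≤m+n _ _
term≤sum f (suc i) = ≤-trans (term≤sum (f ∘ suc) i) (m≤n+m _ _)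

-- Partial sums for loop invariants. The number of completed rounds reaches `n` itself, hence a
-- bound in `ℕ` rather than an index in `Fin n`.
sumBelow : (Fin n → ℕ) → ℕ → ℕ
sumBelow {zero}  f m       = 0
sumBelow {suc n} f zero    = 0
sumBelow {suc n} f (suc m) = f zero + sumBelow (f ∘ suc) m

sumBelow-zero : (f : Fin n → ℕ) → sumBelow f 0 ≡ 0
sumBelow-zero {zero}  f = refl
sumBelow-zero {suc n} f = refl

sumBelow-suc : ∀ (f : Fin n → ℕ) i → sumBelow f (suc (toℕ i)) ≡ sumBelow f (toℕ i) + f i
sumBelow-suc f zero    = trans (cong (f zero +_) (sumBelow-zero (f ∘ suc))) (+-identityʳ _)
sumBelow-suc f (suc i) = trans (cong (f zero +_) (sumBelow-suc (f ∘ suc) i)) (sym (+-assoc (f zero) _ _))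

sumBelow-all : (f : Fin n → ℕ) → sumBelow f n ≡ sum f
sumBelow-all {zero}  f = refl
sumBelow-all {suc n} f = cong (f zero +_) (sumBelow-all (f ∘ suc))

-- `x` is any natural number because the color of a neighbor may be `k`, and then no index below `k`
-- matches it.
∑-indicator≤1 : ∀ m x → ∑[ i < m ] 𝟙 (x ≡ᵇ toℕ i) ≤ 1
∑-indicator≤1 zero    x       = z≤n
∑-indicator≤1 (suc m) zero    = ≤-reflexive (cong suc (sum-zero {m} _ λ _ → refl))
∑-indicator≤1 (suc m) (suc x) = ∑-indicator≤1 m x

∑-indicator : (x : Fin m) → ∑[ i < m ] 𝟙 (toℕ x ≡ᵇ toℕ i) ≡ 1
∑-indicator {m} x = ≤-antisym (∑-indicator≤1 m (toℕ x))
  (subst (_≤ ∑[ i < m ] 𝟙 (toℕ x ≡ᵇ toℕ i)) (cong 𝟙 (≡ᵇ-true {toℕ x} refl))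
    (term≤sum (λ i → 𝟙 (toℕ x ≡ᵇ toℕ i)) x))

∣tabulate∣ : (f : Fin n → Bool) → ∣ tabulate f ∣ ≡ ∑[ v < n ] 𝟙 (f v)
∣tabulate∣ {zero}  f = refl
∣tabulate∣ {suc n} f with f zero
... | true  = cong suc (∣tabulate∣ (f ∘ suc))
... | false = ∣tabulate∣ (f ∘ suc)

-- A function that turns concatenation into addition is determined by its values on singletons. `F`
-- will be the length of a twice filtered list, which makes `ρ` a double sum over vertices.
additive-tabulate : (F : List A → ℕ) → F [] ≡ 0 → (∀ xs ys → F (xs List.++ ys) ≡ F xs + F ys) →
  (f : Fin n → A) → F (List.tabulate f) ≡ ∑[ i < n ] F (f i ∷ [])
additive-tabulate {n = zero}  F F-[] F-++ f = F-[]
additive-tabulate {n = suc n} F F-[] F-++ f =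
  trans (F-++ (f zero ∷ []) _) (cong (F (f zero ∷ []) +_) (additive-tabulate F F-[] F-++ (f ∘ suc)))

additive-cartesianProduct : (F : List (A × B) → ℕ) → F [] ≡ 0 →
  (∀ xs ys → F (xs List.++ ys) ≡ F xs + F ys) →
  (f : Fin m → A) (g : Fin n → B) →
  F (cartesianProduct (List.tabulate f) (List.tabulate g)) ≡ ∑[ i < m ] ∑[ j < n ] F ((f i , g j) ∷ [])
additive-cartesianProduct {m = zero}  F F-[] F-++ f g = F-[]
additive-cartesianProduct {m = suc m} F F-[] F-++ f g = trans (F-++ (map (f zero ,_) (List.tabulate g)) _)
  (cong₂ _+_ (trans (cong F (List.map-tabulate g (f zero ,_))) (additive-tabulate F F-[] F-++ (λ j → f zero , g j)))
             (additive-cartesianProduct F F-[] F-++ (f ∘ suc) g))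

-- A singleton survives both filters only if both predicates hold, so only that case asks for a
-- positive bound.
length-filter₂-≤ : {P : Pred A p} {Q : Pred A q} (P? : Decidable P) (Q? : Decidable Q) →
  ∀ x {b} → (P x → Q x → 1 ≤ b) → length (filter Q? (filter P? (x ∷ []))) ≤ b
length-filter₂-≤ P? Q? x bound with P? x
... | no _ = z≤n
... | yes p with Q? x
...   | no _  = z≤n
...   | yes q = bound p q

-- Enumerations of a set of vertices by a list without repetitions

occurrences : List (Fin n) → Fin n → ℕ
occurrences xs u = ∑[ j < length xs ] 𝟙 (toℕ (lookup xs j) ≡ᵇ toℕ u)

occurrences≤1 : ∀ {xs : List (Fin n)} → Unique xs → ∀ u → occurrences xs u ≤ 1
occurrences≤1 [] u = z≤n
occurrences≤1 {xs = x ∷ xs} (x∉xs ∷ unique) u with toℕ x ≡ᵇ toℕ u in eq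
... | false = occurrences≤1 unique u
... | true  = ≤-reflexive (cong suc (sum-zero {length xs} _ no-more))
  where
  no-more : ∀ j → 𝟙 (toℕ (lookup xs j) ≡ᵇ toℕ u) ≡ 0
  no-more j = cong 𝟙 (≡ᵇ-false λ eq′ → All.lookup x∉xs (∈-lookup j)
    (Fin.toℕ-injective (trans (≡ᵇ-true⁻¹ {toℕ x} eq) (sym eq′))))

module _ {P : Pred (Fin n) p} (P? : Decidable P) (xs : List (Fin n)) where

  -- Double counting of matching pairs of a position and a vertex: each position matches exactly one
  -- vertex, while a vertex matches at most one position, and none if it lies outside `P`.
  length≤∑ : Unique xs → (∀ {u} → u ∈ˡ xs → P u) → length xs ≤ ∑[ u < n ] 𝟙 (does (P? u))
  length≤∑ unique sound = begin
    length xs                                                          ≡⟨ *-identityʳ _ ⟨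
    length xs * 1                                                      ≡⟨ sum-const (length xs) 1 ⟨
    ∑[ j < length xs ] 1                                               ≡⟨ sum-cong-≗ (λ j → sym (∑-indicator (lookup xs j))) ⟩
    ∑[ j < length xs ] ∑[ u < n ] 𝟙 (toℕ (lookup xs j) ≡ᵇ toℕ u)       ≡⟨ ∑-comm {length xs} {n} (λ j u → 𝟙 (toℕ (lookup xs j) ≡ᵇ toℕ u)) ⟩
    ∑[ u < n ] occurrences xs u                                        ≤⟨ sum-mono-≤ occ≤ ⟩
    ∑[ u < n ] 𝟙 (does (P? u))                                         ∎
    where
    open ≤-Reasoning
    occ≤ : ∀ u → occurrences xs u ≤ 𝟙 (does (P? u))
    occ≤ u with P? u
    ... | yes _ = occurrences≤1 unique u
    ... | no ¬p = ≤-reflexive (sum-zero {length xs} _ absent)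
      where
      absent : ∀ j → 𝟙 (toℕ (lookup xs j) ≡ᵇ toℕ u) ≡ 0
      absent j = cong 𝟙 (≡ᵇ-false λ eq →
        ¬p (subst P (Fin.toℕ-injective eq) (sound (∈-lookup j))))

  -- Each `u` in `P` is listed at some position, and the term of that position pays for `g u`.
  ∑≤∑-lookup : (∀ {u} → P u → u ∈ˡ xs) → (g : Fin n → ℕ) →
    ∑[ u < n ] (𝟙 (does (P? u)) * g u) ≤ ∑[ j < length xs ] g (lookup xs j)
  ∑≤∑-lookup complete g = begin
    ∑[ u < n ] (𝟙 (does (P? u)) * g u)              ≤⟨ sum-mono-≤ bound ⟩
    ∑[ u < n ] ∑[ j < length xs ] h j u             ≡⟨ ∑-comm {n} (λ u j → h j u) ⟩
    ∑[ j < length xs ] ∑[ u < n ] h j u             ≡⟨ sum-cong-≗ collapse ⟩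
    ∑[ j < length xs ] g (lookup xs j)              ∎
    where
    open ≤-Reasoning
    h : Fin (length xs) → Fin n → ℕ
    -- The weight is `g` at the listed vertex instead of `g u`. The two agree where the indicator is
    -- 1, and this form is a constant factor in the sum over `u`.
    h j u = g (lookup xs j) * 𝟙 (toℕ (lookup xs j) ≡ᵇ toℕ u)
    collapse : ∀ j → ∑[ u < n ] h j u ≡ g (lookup xs j)
    collapse j = trans (sym (*-distribˡ-sum {n} (g (lookup xs j)) (λ u → 𝟙 (toℕ (lookup xs j) ≡ᵇ toℕ u))))
      (trans (cong (g (lookup xs j) *_) (∑-indicator (lookup xs j))) (*-identityʳ _))
    bound : ∀ u → 𝟙 (does (P? u)) * g u ≤ ∑[ j < length xs ] h j u
    bound u with P? u
    ... | no _  = z≤n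
    ... | yes p = ≤-trans (≤-reflexive at-index) (term≤sum (λ j → h j u) (index (complete p)))
      where
      at-index : g u + 0 ≡ h (index (complete p)) u
      at-index rewrite sym (lookup-index (complete p)) | ≡ᵇ-true {toℕ u} refl =
        trans (+-identityʳ _) (sym (*-identityʳ _))

-- Color classes

∈-colorClass⁻ : (c : Coloring n k) → ∀ {i v} → v ∈ colorClass c i → c v ≡ i
∈-colorClass⁻ c {i} {v} v∈ with c v Fin.≟ i in eq
... | yes cv≡i = cv≡i
... | no _ = contradiction (trans (sym (Vec.[]=⇒lookup v∈)) (trans (Vec.lookup∘tabulate _ v) (cong does eq))) λ ()

∈-colorClass⁺ : (c : Coloring n k) → ∀ {i v} → c v ≡ i → v ∈ colorClass c i
∈-colorClass⁺ c {i} {v} cv≡i =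
  Vec.lookup⇒[]= v _ (trans (Vec.lookup∘tabulate _ v) (dec-true (c v Fin.≟ i) cv≡i))

x∈p─q⇒x∉q : ∀ (p q : Vec.Vec Bool n) {x} → x ∈ p ─ q → x ∉ q
x∈p─q⇒x∉q (_ Vec.∷ p) (_ Vec.∷ q) (Vec.there x∈p─q) (Vec.there x∈q) = x∈p─q⇒x∉q p q x∈p─q x∈q
x∈p─q⇒x∉q (_ Vec.∷ p) (_ Vec.∷ q) () Vec.here

∣colorClass∣ : (c : Coloring n k) → ∀ i → ∣ colorClass c i ∣ ≡ ∑[ v < n ] 𝟙 (toℕ (c v) ≡ᵇ toℕ i)
∣colorClass∣ c i = trans (∣tabulate∣ (λ v → does (c v Fin.≟ i))) (sum-cong-≗ agree)
  where
  agree : ∀ v → 𝟙 (does (c v Fin.≟ i)) ≡ 𝟙 (toℕ (c v) ≡ᵇ toℕ i)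
  agree v with c v Fin.≟ i
  ... | yes cv≡i = cong 𝟙 (sym (≡ᵇ-true (cong toℕ cv≡i)))
  ... | no cv≢i  = cong 𝟙 (sym (≡ᵇ-false (cv≢i ∘ Fin.toℕ-injective)))

degree≤maxDegree : (G : Graph n) → ∀ v → degree G v ≤ maxDegree G
degree≤maxDegree G v = All.lookup (xs≤max 0 (map (degree G) (allFin _))) (∈-map⁺ (degree G) (∈-allFin v))

-- Moving the last color class onto one color

-- The color classes partition the vertices; this is the exchange of sums in the middle, after which
-- each vertex counts once.
smallest-class-bound : (c : Coloring n (suc k)) →
  (∀ i → ∣ colorClass c (fromℕ k) ∣ ≤ ∣ colorClass c i ∣) →
  suc k * ∣ colorClass c (fromℕ k) ∣ ≤ n
smallest-class-bound {n} {k} c smallest = begin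
  suc k * ∣ colorClass c (fromℕ k) ∣                         ≡⟨ sum-const (suc k) _ ⟨
  ∑[ i < suc k ] ∣ colorClass c (fromℕ k) ∣                  ≤⟨ sum-mono-≤ smallest ⟩
  ∑[ i < suc k ] ∣ colorClass c i ∣                          ≡⟨ sum-cong-≗ (∣colorClass∣ c) ⟩
  ∑[ i < suc k ] ∑[ v < n ] 𝟙 (toℕ (c v) ≡ᵇ toℕ i)           ≡⟨ ∑-comm {suc k} {n} (λ i v → 𝟙 (toℕ (c v) ≡ᵇ toℕ i)) ⟩
  ∑[ v < n ] ∑[ i < suc k ] 𝟙 (toℕ (c v) ≡ᵇ toℕ i)           ≡⟨ sum-cong-≗ (λ v → ∑-indicator (c v)) ⟩
  ∑[ v < n ] 1                                               ≡⟨ sum-const n 1 ⟩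
  n * 1                                                      ≡⟨ *-identityʳ n ⟩
  n                                                          ∎
  where open ≤-Reasoning

-- Acts on the natural numbers that the machine stores, where the last color is the number `k`.
merge : ℕ → ℕ → ℕ → ℕ
merge k b x = if x ≡ᵇ k then b else x

merge-top : ∀ k b {x} → x ≡ k → merge k b x ≡ b
merge-top k b {x} x≡k = cong (if_then b else x) (≡ᵇ-true x≡k)

merge-other : ∀ k b {x} → x ≢ k → merge k b x ≡ x
merge-other k b {x} x≢k = cong (if_then b else x) (≡ᵇ-false x≢k)

module _ {n k : ℕ} (G : Graph n) (c : Coloring n (suc k)) (adj : Fin n → List (Fin n)) where
  open Graph G

  tops : ℕ
  tops = ∣ colorClass c (fromℕ k) ∣

  tops≡∑ : tops ≡ ∑[ v < n ] 𝟙 (toℕ (c v) ≡ᵇ k)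
  tops≡∑ = trans (∣colorClass∣ c (fromℕ k)) (sum-cong-≗ λ v → cong (λ x → 𝟙 (toℕ (c v) ≡ᵇ x)) (Fin.toℕ-fromℕ k))

  hit : ℕ → (v : Fin n) → Fin (length (adj v)) → ℕ
  hit i v j = 𝟙 (toℕ (c (lookup (adj v) j)) ≡ᵇ i)

  cutAt : ℕ → Fin n → ℕ
  cutAt i v = 𝟙 (toℕ (c v) ≡ᵇ k) * sum (hit i v)

  -- For `i` below `k` and lists that represent the graph, this is the number of edges between the
  -- last class and class `i`: each is seen once, from its end in the last class. The sum over list
  -- positions mirrors the traversal made by the program.
  cut : ℕ → ℕ
  cut i = sum (cutAt i)

  module _ (unique : ∀ v → Unique (adj v)) (complete : ∀ {u v} → u ∈ˡ adj v ⇔ v ~ u) where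

    length-adj : ∀ v → length (adj v) ≤ maxDegree G
    length-adj v = begin
      length (adj v)                  ≤⟨ length≤∑ (v ~?_) (adj v) (unique v) (Equivalence.to complete) ⟩
      ∑[ u < n ] 𝟙 (does (v ~? u))    ≡⟨ ∣tabulate∣ (λ u → does (v ~? u)) ⟨
      degree G v                      ≤⟨ degree≤maxDegree G v ⟩
      maxDegree G                     ∎
      where open ≤-Reasoning

    -- A vertex of the last class has at most `maxDegree G` list entries, and each entry contributes
    -- to the cut of at most one color below `k`.
    ∑-cut≤ : ∑[ i < k ] cut (toℕ i) ≤ tops * maxDegree G
    ∑-cut≤ = begin
      ∑[ i < k ] ∑[ v < n ] cutAt (toℕ i) v               ≡⟨ ∑-comm {k} {n} (λ i v → cutAt (toℕ i) v) ⟩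
      ∑[ v < n ] ∑[ i < k ] cutAt (toℕ i) v               ≤⟨ sum-mono-≤ at ⟩
      ∑[ v < n ] (maxDegree G * 𝟙 (toℕ (c v) ≡ᵇ k))       ≡⟨ *-distribˡ-sum (maxDegree G) (λ v → 𝟙 (toℕ (c v) ≡ᵇ k)) ⟨
      maxDegree G * ∑[ v < n ] 𝟙 (toℕ (c v) ≡ᵇ k)         ≡⟨ cong (maxDegree G *_) tops≡∑ ⟨
      maxDegree G * tops                                  ≡⟨ *-comm (maxDegree G) tops ⟩
      tops * maxDegree G                                  ∎
      where
      open ≤-Reasoning
      at : ∀ v → ∑[ i < k ] cutAt (toℕ i) v ≤ maxDegree G * 𝟙 (toℕ (c v) ≡ᵇ k)
      at v = begin
        ∑[ i < k ] cutAt (toℕ i) v                                         ≡⟨ *-distribˡ-sum (𝟙 (toℕ (c v) ≡ᵇ k)) (λ (i : Fin k) → sum (hit (toℕ i) v)) ⟨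
        𝟙 (toℕ (c v) ≡ᵇ k) * ∑[ i < k ] sum (hit (toℕ i) v)                ≡⟨ cong (𝟙 (toℕ (c v) ≡ᵇ k) *_) (∑-comm {k} (λ i j → hit (toℕ i) v j)) ⟩
        𝟙 (toℕ (c v) ≡ᵇ k) * ∑[ j < length (adj v) ] ∑[ i < k ] hit (toℕ i) v j
          ≤⟨ *-monoʳ-≤ (𝟙 (toℕ (c v) ≡ᵇ k)) (sum-mono-≤ λ j → ∑-indicator≤1 k (toℕ (c (lookup (adj v) j)))) ⟩
        𝟙 (toℕ (c v) ≡ᵇ k) * ∑[ j < length (adj v) ] 1                     ≡⟨ cong (𝟙 (toℕ (c v) ≡ᵇ k) *_) (trans (sum-const (length (adj v)) 1) (*-identityʳ _)) ⟩
        𝟙 (toℕ (c v) ≡ᵇ k) * length (adj v)                                ≤⟨ *-monoʳ-≤ (𝟙 (toℕ (c v) ≡ᵇ k)) (length-adj v) ⟩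
        𝟙 (toℕ (c v) ≡ᵇ k) * maxDegree G                                   ≡⟨ *-comm (𝟙 (toℕ (c v) ≡ᵇ k)) _ ⟩
        maxDegree G * 𝟙 (toℕ (c v) ≡ᵇ k)                                   ∎

    module _ (b : ℕ) (c′ : Coloring n k) (merged : ∀ v → toℕ (c′ v) ≡ merge k b (toℕ (c v))) where

      -- Deliberately asymmetric: `u` is the recolored end, and `v` is the end that had color `b`
      -- before.
      conflict : Fin n → Fin n → ℕ
      conflict u v = 𝟙 (toℕ (c u) ≡ᵇ k) * (𝟙 (does (u ~? v)) * 𝟙 (toℕ (c v) ≡ᵇ b))

      ∑-conflict≤cutAt : ∀ u → ∑[ v < n ] conflict u v ≤ cutAt b u
      ∑-conflict≤cutAt u = ≤-trans
        (≤-reflexive (sym (*-distribˡ-sum (𝟙 (toℕ (c u) ≡ᵇ k)) (λ v → 𝟙 (does (u ~? v)) * 𝟙 (toℕ (c v) ≡ᵇ b)))))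
        (*-monoʳ-≤ (𝟙 (toℕ (c u) ≡ᵇ k))
          (∑≤∑-lookup (u ~?_) (adj u) (Equivalence.from complete) (λ v → 𝟙 (toℕ (c v) ≡ᵇ b))))

      module _ (legal : Legal G c) where

        -- The last class is independent, so the neighbor `v` of `u` keeps its color. As it now
        -- shares the color of `u`, that color was `b` all along.
        conflict≡1 : ∀ {u v} → u ~ v → toℕ (c u) ≡ k → toℕ (c′ u) ≡ toℕ (c′ v) → conflict u v ≡ 1
        conflict≡1 {u} {v} u~v cu≡k c′u≡c′v =
          cong₂ _*_ (cong 𝟙 (≡ᵇ-true cu≡k)) (cong₂ _*_ (cong 𝟙 (dec-true (u ~? v) u~v)) (cong 𝟙 (≡ᵇ-true cv≡b)))
          where
          cv≢k : toℕ (c v) ≢ k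
          cv≢k cv≡k = legal u~v (Fin.toℕ-injective (trans cu≡k (sym cv≡k)))
          cv≡b : toℕ (c v) ≡ b
          cv≡b = trans (sym (merge-other k b cv≢k)) (trans (sym (merged v))
                   (trans (sym c′u≡c′v) (trans (merged u) (merge-top k b cu≡k))))

        -- If neither end were in the last class, both would keep their colors and the conflict
        -- would already be present in `c`. So one end is recolored, and the edge is charged to the
        -- orientation starting there.
        conflict-edge : ∀ {u v} → u ~ v → c′ u ≡ c′ v → 1 ≤ conflict u v + conflict v u
        conflict-edge {u} {v} u~v c′u≡c′v with toℕ (c u) ≟ k | toℕ (c v) ≟ k
        ... | yes cu≡k | _ = ≤-trans (≤-reflexive (sym (conflict≡1 u~v cu≡k (cong toℕ c′u≡c′v)))) (m≤m+n _ _)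
        ... | no _ | yes cv≡k = ≤-trans (≤-reflexive (sym (conflict≡1 (~-sym u~v) cv≡k (cong toℕ (sym c′u≡c′v))))) (m≤n+m _ (conflict u v))
        ... | no cu≢k | no cv≢k = contradiction
          (Fin.toℕ-injective (begin
            toℕ (c u)                ≡⟨ merge-other k b cu≢k ⟨
            merge k b (toℕ (c u))    ≡⟨ merged u ⟨
            toℕ (c′ u)               ≡⟨ cong toℕ c′u≡c′v ⟩
            toℕ (c′ v)               ≡⟨ merged v ⟩
            merge k b (toℕ (c v))    ≡⟨ merge-other k b cv≢k ⟩
            toℕ (c v)                ∎))
          (legal u~v)
          where open ≡-Reasoning

        _≺ᶠ_ : Fin n → Fin n → ℕ
        u ≺ᶠ v = 𝟙 (toℕ u <ᵇ toℕ v)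

        -- An edge with ends u < v is charged to the orientation whose tail is recolored.
        ρ≤cut : ρ G c′ ≤ cut b
        ρ≤cut = begin
          ρ G c′
            ≡⟨ additive-cartesianProduct F refl F-++ (λ u → u) (λ v → v) ⟩
          ∑[ u < n ] ∑[ v < n ] F ((u , v) ∷ [])
            ≤⟨ sum-mono-≤ (λ u → sum-mono-≤ λ v → length-filter₂-≤ E? Q? (u , v) (pair u v)) ⟩
          ∑[ u < n ] ∑[ v < n ] (u ≺ᶠ v * conflict u v + u ≺ᶠ v * conflict v u)
            ≡⟨ sum-cong-≗ (λ u → ∑-distrib-+ (λ v → u ≺ᶠ v * conflict u v) (λ v → u ≺ᶠ v * conflict v u)) ⟩
          ∑[ u < n ] (∑[ v < n ] (u ≺ᶠ v * conflict u v) + ∑[ v < n ] (u ≺ᶠ v * conflict v u))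
            ≡⟨ ∑-distrib-+ (λ u → ∑[ v < n ] (u ≺ᶠ v * conflict u v)) (λ u → ∑[ v < n ] (u ≺ᶠ v * conflict v u)) ⟩
          ∑[ u < n ] ∑[ v < n ] (u ≺ᶠ v * conflict u v) + ∑[ u < n ] ∑[ v < n ] (u ≺ᶠ v * conflict v u)
            -- Exchanging the sums swaps the names `u` and `v` in the second half. Both halves then
            -- weigh the same `conflict u v`, under two orders that exclude each other.
            ≡⟨ cong (∑[ u < n ] ∑[ v < n ] (u ≺ᶠ v * conflict u v) +_) (∑-comm {n} {n} (λ u v → u ≺ᶠ v * conflict v u)) ⟩
          ∑[ u < n ] ∑[ v < n ] (u ≺ᶠ v * conflict u v) + ∑[ u < n ] ∑[ v < n ] (v ≺ᶠ u * conflict u v)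
            ≡⟨ ∑-distrib-+ (λ u → ∑[ v < n ] (u ≺ᶠ v * conflict u v)) (λ u → ∑[ v < n ] (v ≺ᶠ u * conflict u v)) ⟨
          ∑[ u < n ] (∑[ v < n ] (u ≺ᶠ v * conflict u v) + ∑[ v < n ] (v ≺ᶠ u * conflict u v))
            ≡⟨ sum-cong-≗ (λ u → ∑-distrib-+ (λ v → u ≺ᶠ v * conflict u v) (λ v → v ≺ᶠ u * conflict u v)) ⟨
          ∑[ u < n ] ∑[ v < n ] (u ≺ᶠ v * conflict u v + v ≺ᶠ u * conflict u v)
            ≤⟨ sum-mono-≤ (λ u → sum-mono-≤ λ v → once u v) ⟩
          ∑[ u < n ] ∑[ v < n ] conflict u v
            ≤⟨ sum-mono-≤ ∑-conflict≤cutAt ⟩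
          cut b ∎
          where
          open ≤-Reasoning
          E? : (e : Fin n × Fin n) → Dec (proj₁ e Fin.< proj₂ e × proj₁ e ~ proj₂ e)
          E? (u , v) = (u Fin.<? v) ×-dec (u ~? v)
          Q? : (e : Fin n × Fin n) → Dec (c′ (proj₁ e) ≡ c′ (proj₂ e))
          Q? (u , v) = c′ u Fin.≟ c′ v
          F : List (Fin n × Fin n) → ℕ
          F xs = length (filter Q? (filter E? xs))
          F-++ : ∀ xs ys → F (xs List.++ ys) ≡ F xs + F ys
          F-++ xs ys = trans
            (cong (length ∘ filter Q?) (List.filter-++ E? xs ys))
            (trans (cong length (List.filter-++ Q? (filter E? xs) (filter E? ys)))
                   (List.length-++ (filter Q? (filter E? xs))))
          pair : ∀ u v → (u Fin.< v × u ~ v) → c′ u ≡ c′ v → 1 ≤ u ≺ᶠ v * conflict u v + u ≺ᶠ v * conflict v u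
          pair u v (u<v , u~v) c′u≡c′v rewrite <ᵇ-true u<v | +-identityʳ (conflict u v) | +-identityʳ (conflict v u) =
            conflict-edge u~v c′u≡c′v
          once : ∀ u v → u ≺ᶠ v * conflict u v + v ≺ᶠ u * conflict u v ≤ conflict u v
          once u v with toℕ u <ᵇ toℕ v in lt | toℕ v <ᵇ toℕ u in gt
          ... | false | false = z≤n
          ... | false | true  = ≤-reflexive (+-identityʳ _)
          ... | true  | false = ≤-reflexive (trans (+-identityʳ _) (+-identityʳ _))
          ... | true  | true  = contradiction (<ᵇ-true⁻¹ {toℕ u} lt) (<-asym (<ᵇ-true⁻¹ {toℕ v} gt))

      merged∈𝓡 : c′ ∈𝓡 c
      merged∈𝓡 i = keep , gain
        where
        keep : ∀ {v} → v ∈ colorClass c (inject₁ i) → v ∈ colorClass c′ i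
        keep {v} v∈ = ∈-colorClass⁺ c′ (Fin.toℕ-injective (trans (merged v)
          (trans (merge-other k b λ cv≡k → <-irrefl (trans (sym cv≡i) cv≡k) (Fin.toℕ<n i)) cv≡i)))
          where
          cv≡i : toℕ (c v) ≡ toℕ i
          cv≡i = trans (cong toℕ (∈-colorClass⁻ c v∈)) (Fin.toℕ-inject₁ i)
        gain : ∀ {v} → v ∈ colorClass c′ i ─ colorClass c (inject₁ i) → v ∈ colorClass c (fromℕ k)
        gain {v} v∈ with toℕ (c v) ≟ k
        ... | yes cv≡k = ∈-colorClass⁺ c (Fin.toℕ-injective (trans cv≡k (sym (Fin.toℕ-fromℕ k))))
        -- A vertex outside the last class keeps its color, hence had color `i` already in `c`,
        -- which membership in the difference rules out.
        ... | no cv≢k = contradiction (∈-colorClass⁺ c (Fin.toℕ-injective (begin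
            toℕ (c v)                ≡⟨ merge-other k b cv≢k ⟨
            merge k b (toℕ (c v))    ≡⟨ merged v ⟨
            toℕ (c′ v)               ≡⟨ cong toℕ (∈-colorClass⁻ c′ (p─q⊆p _ _ v∈)) ⟩
            toℕ i                    ≡⟨ Fin.toℕ-inject₁ i ⟨
            toℕ (inject₁ i)          ∎))) (x∈p─q⇒x∉q _ _ v∈)
          where open ≡-Reasoning

-- Running times and postconditions

-- A total-correctness triple with a time budget. An upper bound instead of the exact time lets both
-- branches of a conditional share one budget.
Runs : Program → State → ℕ → (State → Set) → Set
Runs P s T Q = ∃[ s′ ] ∃[ t ] (⟨ P , s ⟩⇓⟨ s′ , t ⟩ × t ≤ T × Q s′)

module _ {Q : State → Set} where

  runs-skip : ∀ {s} → Q s → Runs skip s 1 Q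
  runs-skip q = _ , _ , ⇓-skip , ≤-refl , q

  runs-assign : ∀ {x e s} → Q (setVar x (eval e s) s) → Runs (x ≔ e) s (suc (cost e)) Q
  runs-assign q = _ , _ , ⇓-assign , ≤-refl , q

  runs-store : ∀ {a d e s} → Q (setCell a (eval d s) (eval e s) s) →
    Runs (a [ d ]≔ e) s (suc (cost d + cost e)) Q
  runs-store q = _ , _ , ⇓-store , ≤-refl , q

  runs-cond : ∀ {b P P′ s T} →
    (test b s ≡ true → Runs P s T Q) → (test b s ≡ false → Runs P′ s T Q) →
    Runs (cond b P P′) s (testCost b + T) Q
  runs-cond {b} {s = s} yes-branch no-branch with test b s in eq
  ... | true  = let s′ , t , run , t≤ , q = yes-branch refl in
    s′ , _ , ⇓-then eq run , +-monoʳ-≤ (testCost b) t≤ , q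
  ... | false = let s′ , t , run , t≤ , q = no-branch refl in
    s′ , _ , ⇓-else eq run , +-monoʳ-≤ (testCost b) t≤ , q

  runs-weaken : ∀ {P s T T′} → T ≤ T′ → Runs P s T Q → Runs P s T′ Q
  runs-weaken T≤T′ (s′ , t , run , t≤T , q) = s′ , t , run , ≤-trans t≤T T≤T′ , q

runs-seq : ∀ {P P′ s T T′} {Q R : State → Set} →
  Runs P s T Q → (∀ s′ → Q s′ → Runs P′ s′ T′ R) → Runs (P ⨾ P′) s (T + T′) R
runs-seq (s₁ , t₁ , run₁ , t₁≤ , q) next with next s₁ q
... | s₂ , t₂ , run₂ , t₂≤ , r = s₂ , _ , ⇓-seq run₁ run₂ , +-mono-≤ t₁≤ t₂≤ , r

-- Each loop of the program makes a number of rounds fixed on entry, so the invariant is indexed by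
-- completed rounds. The last `testCost b` pays for the failing test.
runs-while : ∀ {b P K} n (Inv : ℕ → State → Set) →
  (∀ (i : Fin n) s → Inv (toℕ i) s → test b s ≡ true × Runs P s K (Inv (suc (toℕ i)))) →
  (∀ s → Inv n s → test b s ≡ false) →
  ∀ s → Inv 0 s → Runs (while b P) s (n * (testCost b + K) + testCost b) (Inv n)
runs-while zero Inv step stop s inv = s , _ , ⇓-done (stop s inv) , ≤-refl , inv
runs-while {b} {K = K} (suc n) Inv step stop s inv with step zero s inv
... | enter , s₁ , t₁ , run₁ , t₁≤ , inv₁ with runs-while n (Inv ∘ suc) (step ∘ suc) stop s₁ inv₁
...   | s₂ , t₂ , run₂ , t₂≤ , inv₂ = s₂ , _ , ⇓-loop enter run₁ run₂ , bound , inv₂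
  where
  bound : testCost b + (t₁ + t₂) ≤ testCost b + K + n * (testCost b + K) + testCost b
  bound = ≤-trans (+-monoʳ-≤ (testCost b) (+-mono-≤ t₁≤ t₂≤)) (≤-reflexive
    (solve 3 (λ b K r → b :+ (K :+ (r :+ b)) := b :+ K :+ r :+ b) refl (testCost b) K (n * (testCost b + K))))
    where open +-*-Solver

update-same : ∀ {A : Set} (f : ℕ → A) {x a y} → y ≡ x → update f x a y ≡ a
update-same f {a = a} {y} y≡x = cong (if_then a else f y) (≡ᵇ-true y≡x)

update-other : ∀ {A : Set} (f : ℕ → A) {x a y} → y ≢ x → update f x a y ≡ f y
update-other f {a = a} {y} y≢x = cong (if_then a else f y) (≡ᵇ-false y≢x)

-- The recoloring program

vertexVar positionVar bestVar : ℕ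
vertexVar   = 2
positionVar = 3
bestVar     = 4

countArr : ℕ
countArr = 3

forVertices : Program → Program
forVertices P =
  vertexVar ≔ lit 0 ⨾
  while (var vertexVar ≺ var orderVar) (P ⨾ vertexVar ≔ var vertexVar ⊕ lit 1)

whenTop : Program → Program
whenTop P = cond (colorArr [ var vertexVar ] ≐ var colorsVar) P skip

-- `clearCount` and `improveBest` read `vertexVar` as a color. Since it stays below `n`, the
-- selection inspects only the colors below both `n` and `k`.
clearCount countNeighbour countNeighbours improveBest recolor mergeProgram : Program
clearCount = countArr [ var vertexVar ]≔ lit 0
countNeighbour =
  countArr [ colorArr [ adjArr [ var positionVar ] ] ]≔
    countArr [ colorArr [ adjArr [ var positionVar ] ] ] ⊕ lit 1 ⨾
  positionVar ≔ var positionVar ⊕ lit 1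
countNeighbours =
  positionVar ≔ startArr [ var vertexVar ] ⨾
  while (var positionVar ≺ startArr [ var vertexVar ⊕ lit 1 ]) countNeighbour
improveBest =
  cond (var vertexVar ≺ var colorsVar)
    (cond (countArr [ var vertexVar ] ≺ countArr [ var bestVar ]) (bestVar ≔ var vertexVar) skip)
    skip
recolor = colorArr [ var vertexVar ]≔ var bestVar
mergeProgram =
  forVertices clearCount ⨾
  forVertices (whenTop countNeighbours) ⨾
  bestVar ≔ lit 0 ⨾
  forVertices improveBest ⨾
  forVertices (whenTop recolor)

-- The first hypothesis makes the invariant insensitive to the loop variable. The 5 is the initial
-- assignment (2) with the failing test (3); the 7 is one successful test (3) with one increment
-- (4).
runs-forVertices : ∀ {n P K} (Inv : ℕ → State → Set) →
  (∀ {m s} x → Inv m s → Inv m (setVar vertexVar x s)) →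
  (∀ {m s} → Inv m s → vars s orderVar ≡ n) →
  (∀ (v : Fin n) s → vars s vertexVar ≡ toℕ v → Inv (toℕ v) s →
    Runs P s K (λ s′ → vars s′ vertexVar ≡ toℕ v × Inv (suc (toℕ v)) s′)) →
  ∀ s → Inv 0 s → Runs (forVertices P) s (5 + n * (7 + K)) (Inv n)
runs-forVertices {n} {P} {K} Inv stable order step s inv =
  runs-weaken (≤-reflexive (cost-eq K n))
    (runs-seq {Q = Inv′ 0} (runs-assign (refl , stable 0 inv)) λ s₁ inv₁ →
      let s₂ , t , run , t≤ , _ , inv₂ = runs-while n Inv′ body stop s₁ inv₁ in s₂ , t , run , t≤ , inv₂)
  where
  Inv′ : ℕ → State → Set
  Inv′ m s = vars s vertexVar ≡ m × Inv m s
  body : ∀ (v : Fin n) s → Inv′ (toℕ v) s →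
    test (var vertexVar ≺ var orderVar) s ≡ true ×
    Runs (P ⨾ vertexVar ≔ var vertexVar ⊕ lit 1) s (K + 4) (Inv′ (suc (toℕ v)))
  body v s (at-v , inv) =
    trans (cong₂ _<ᵇ_ at-v (order inv)) (<ᵇ-true (Fin.toℕ<n v)) ,
    runs-seq (step v s at-v inv) λ s′ (at-v′ , inv′) →
      runs-assign (trans (cong (_+ 1) at-v′) (+-comm (toℕ v) 1) , stable _ inv′)
  stop : ∀ s → Inv′ n s → test (var vertexVar ≺ var orderVar) s ≡ false
  stop s (at-n , inv) = trans (cong₂ _<ᵇ_ at-n (order inv)) (<ᵇ-false (≤-refl {n}))
  cost-eq : ∀ K n → 2 + (n * (3 + (K + 4)) + 3) ≡ 5 + n * (7 + K)
  cost-eq = solve 2 (λ K n → con 2 :+ (n :* (con 3 :+ (K :+ con 4)) :+ con 3) := con 5 :+ n :* (con 7 :+ K)) refl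
    where open +-*-Solver

-- One summand for each pass: clear, count, select (with 2 for initializing `bestVar`), recolor. In
-- the counting pass a list entry costs 20, namely 6 for the loop test and 14 for the body; the 9 is
-- loading the start position (3) and the failing test (6). The 4 is the test for the last class.
mergeCost : ℕ → ℕ → ℕ
mergeCost n Δ = (5 + n * 10) + ((5 + n * (7 + (4 + (9 + Δ * 20)))) + ((2 + (5 + n * 17)) + (5 + n * 14)))

-- Loop invariants and running time of the four passes

module _ {n k : ℕ} {G : Graph n} (c : Coloring n (suc k)) (k>0 : 0 < k) (s₀ : State) (input : Input G c s₀) where
  open Input input

  -- The arrays are equated as whole functions, so that writes to `countArr` and to the working
  -- variables preserve the frame by computation alone.
  Frame : State → Set
  Frame s = vars s orderVar ≡ n × vars s colorsVar ≡ k ×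
    arrs s startArr ≡ arrs s₀ startArr × arrs s adjArr ≡ arrs s₀ adjArr × arrs s colorArr ≡ arrs s₀ colorArr

  color-at : ∀ {s} → Frame s → ∀ v → arrs s colorArr (toℕ v) ≡ toℕ (c v)
  color-at (_ , _ , _ , _ , eq) v = trans (cong (λ f → f (toℕ v)) eq) (coloring v)

  -- The hypothesis concerns the color of `v` alone, because in the recoloring pass the vertices
  -- already visited may have lost their original colors. `1 ≤ K` pays for `skip`.
  runs-whenTop : ∀ {P K Q} v s → vars s vertexVar ≡ toℕ v → vars s colorsVar ≡ k →
    arrs s colorArr (toℕ v) ≡ toℕ (c v) → 1 ≤ K →
    (toℕ (c v) ≡ k → Runs P s K Q) → (toℕ (c v) ≢ k → Q s) → Runs (whenTop P) s (4 + K) Q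
  runs-whenTop {P} {K} {Q} v s at-v colors≡k color≡ 1≤K top other = runs-cond
    (λ eq → top (≡ᵇ-true⁻¹ (trans (sym test≡) eq)))
    (λ eq → runs-weaken 1≤K (runs-skip (other λ cv≡k →
      contradiction (trans (sym (≡ᵇ-true cv≡k)) (trans (sym test≡) eq)) λ ())))
    where
    test≡ : (arrs s colorArr (vars s vertexVar) ≡ᵇ vars s colorsVar) ≡ (toℕ (c v) ≡ᵇ k)
    test≡ = cong₂ _≡ᵇ_ (trans (cong (arrs s colorArr) at-v) color≡) colors≡k

  Cleared : ℕ → State → Set
  Cleared m s = Frame s × (∀ i → i < m → arrs s countArr i ≡ 0)

  runs-clear : Runs (forVertices clearCount) s₀ (5 + n * 10) (Cleared n)
  runs-clear = runs-forVertices Cleared (λ _ inv → inv) (λ (frame , _) → proj₁ frame)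
    (λ v s at-v (frame , zeros) → runs-store (at-v , frame , zeros′ v s at-v zeros))
    s₀ ((order , colors , refl , refl , refl) , λ _ ())
    where
    zeros′ : ∀ (v : Fin n) s → vars s vertexVar ≡ toℕ v → (∀ i → i < toℕ v → arrs s countArr i ≡ 0) →
      ∀ i → i < suc (toℕ v) → update (arrs s countArr) (vars s vertexVar) 0 i ≡ 0
    zeros′ v s at-v zeros i i≤v with i ≟ toℕ v
    ... | yes i≡v = update-same (arrs s countArr) (trans i≡v (sym at-v))
    ... | no i≢v = trans (update-other (arrs s countArr) (λ i≡ → i≢v (trans i≡ at-v)))
                         (zeros i (≤∧≢⇒< (s≤s⁻¹ i≤v) i≢v))

  -- Cells from `n` on were never cleared and hold arbitrary contents, so nothing is claimed about
  -- them.
  Counted : ℕ → State → Set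
  Counted m s = Frame s × (∀ i → i < n → arrs s countArr i ≡ sumBelow (cutAt G c adj i) m)

  module _ {Δ : ℕ} (length≤Δ : ∀ v → length (adj v) ≤ Δ) where

    runs-countNeighbours : ∀ v s → vars s vertexVar ≡ toℕ v → toℕ (c v) ≡ k → Counted (toℕ v) s →
      Runs countNeighbours s (9 + Δ * 20) (λ s′ → vars s′ vertexVar ≡ toℕ v × Counted (suc (toℕ v)) s′)
    runs-countNeighbours v s at-v cv≡k (frame , counts) =
      runs-weaken (+-monoʳ-≤ 3 (≤-trans (+-monoˡ-≤ 6 (*-monoˡ-≤ 20 (length≤Δ v))) (≤-reflexive (+-comm _ 6))))
        (runs-seq {Q = Inv 0} (runs-assign start-inv) λ s₁ inv →
          finish (runs-while (length (adj v)) Inv body stop s₁ inv))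
      where
      base : ℕ → ℕ
      base i = sumBelow (cutAt G c adj i) (toℕ v)
      Inv : ℕ → State → Set
      Inv m s = vars s vertexVar ≡ toℕ v × vars s positionVar ≡ arrs s₀ startArr (toℕ v) + m × Frame s ×
        (∀ i → i < n → arrs s countArr i ≡ base i + sumBelow (hit G c adj i v) m)
      start-inv : Inv 0 (setVar positionVar (arrs s startArr (vars s vertexVar)) s)
      start-inv = at-v ,
        trans (cong₂ (λ f x → f x) (proj₁ (proj₂ (proj₂ frame))) at-v) (sym (+-identityʳ _)) , frame ,
        λ i i<n → trans (counts i i<n) (sym (trans (cong (base i +_) (sumBelow-zero (hit G c adj i v))) (+-identityʳ _)))
      test≡ : ∀ m s → Inv m s → test (var positionVar ≺ startArr [ var vertexVar ⊕ lit 1 ]) s ≡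
        (arrs s₀ startArr (toℕ v) + m <ᵇ arrs s₀ startArr (toℕ v) + length (adj v))
      test≡ m s (at-v , at-m , (_ , _ , starts , _) , _) = cong₂ _<ᵇ_ at-m
        (trans (cong₂ (λ f x → f x) starts (trans (cong (_+ 1) at-v) (+-comm (toℕ v) 1))) (start v))
      stop : ∀ s → Inv (length (adj v)) s → test (var positionVar ≺ startArr [ var vertexVar ⊕ lit 1 ]) s ≡ false
      stop s inv = trans (test≡ _ s inv) (<ᵇ-false (≤-refl {arrs s₀ startArr (toℕ v) + length (adj v)}))
      body : ∀ (j : Fin (length (adj v))) s → Inv (toℕ j) s →
        test (var positionVar ≺ startArr [ var vertexVar ⊕ lit 1 ]) s ≡ true ×
        Runs countNeighbour s 14 (Inv (suc (toℕ j)))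
      body j s inv@(at-v , at-j , frame , counts) =
        trans (test≡ _ s inv) (<ᵇ-true (+-monoʳ-< (arrs s₀ startArr (toℕ v)) (Fin.toℕ<n j))) ,
        runs-seq {Q = λ s′ → vars s′ vertexVar ≡ toℕ v ×
            vars s′ positionVar ≡ arrs s₀ startArr (toℕ v) + toℕ j × Frame s′ ×
            (∀ i → i < n → arrs s′ countArr i ≡ base i + sumBelow (hit G c adj i v) (suc (toℕ j)))}
          (runs-store (at-v , at-j , frame , counts′))
          λ s′ (at-v , at-j , frame , counts) → runs-assign
            (at-v , trans (cong (_+ 1) at-j) (trans (+-comm _ 1) (sym (+-suc _ (toℕ j)))) , frame , counts)
        where
        color : ℕ
        color = arrs s colorArr (arrs s adjArr (vars s positionVar))
        color≡ : color ≡ toℕ (c (lookup (adj v) j))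
        color≡ = trans (cong (arrs s colorArr)
          (trans (cong₂ (λ f x → f x) (proj₁ (proj₂ (proj₂ (proj₂ frame)))) at-j) (entry v j)))
          (color-at {s} frame _)
        counts′ : ∀ i → i < n → update (arrs s countArr) color (arrs s countArr color + 1) i ≡
          base i + sumBelow (hit G c adj i v) (suc (toℕ j))
        counts′ i i<n = begin
          update (arrs s countArr) color (arrs s countArr color + 1) i   ≡⟨ increment ⟩
          arrs s countArr i + hit G c adj i v j                         ≡⟨ cong (_+ hit G c adj i v j) (counts i i<n) ⟩
          base i + sumBelow (hit G c adj i v) (toℕ j) + hit G c adj i v j ≡⟨ +-assoc (base i) _ _ ⟩
          base i + (sumBelow (hit G c adj i v) (toℕ j) + hit G c adj i v j) ≡⟨ cong (base i +_) (sumBelow-suc (hit G c adj i v) j) ⟨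
          base i + sumBelow (hit G c adj i v) (suc (toℕ j))              ∎
          where
          open ≡-Reasoning
          -- The incremented cell may lie at or beyond `n`; the second case then applies to every
          -- `i` of the invariant.
          increment : update (arrs s countArr) color (arrs s countArr color + 1) i ≡ arrs s countArr i + hit G c adj i v j
          increment with i ≟ color
          ... | yes i≡color = trans (update-same (arrs s countArr) i≡color)
            (cong₂ _+_ (cong (arrs s countArr) (sym i≡color)) (sym (cong 𝟙 (≡ᵇ-true (trans (sym color≡) (sym i≡color))))))
          ... | no i≢color = trans (update-other (arrs s countArr) i≢color)
            (sym (trans (cong (λ b → arrs s countArr i + 𝟙 b) (≡ᵇ-false λ eq → i≢color (sym (trans color≡ eq)))) (+-identityʳ _)))
      finish : ∀ {P s T} → Runs P s T (Inv (length (adj v))) →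
        Runs P s T (λ s′ → vars s′ vertexVar ≡ toℕ v × Counted (suc (toℕ v)) s′)
      finish (s′ , t , run , t≤ , at-v , _ , frame , counts) = s′ , t , run , t≤ , at-v , frame , λ i i<n →
        begin
          arrs s′ countArr i                                            ≡⟨ counts i i<n ⟩
          base i + sumBelow (hit G c adj i v) (length (adj v))          ≡⟨ cong (base i +_) (sumBelow-all (hit G c adj i v)) ⟩
          base i + sum (hit G c adj i v)                                ≡⟨ cong (base i +_) (sym (trans (cong (λ b → 𝟙 b * sum (hit G c adj i v)) (≡ᵇ-true cv≡k)) (+-identityʳ _))) ⟩
          base i + cutAt G c adj i v                                    ≡⟨ sumBelow-suc (cutAt G c adj i) v ⟨
          sumBelow (cutAt G c adj i) (suc (toℕ v))                      ∎
        where open ≡-Reasoning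

    runs-count : ∀ s → Cleared n s → Runs (forVertices (whenTop countNeighbours)) s (5 + n * (7 + (4 + (9 + Δ * 20)))) (Counted n)
    runs-count s (frame , zeros) = runs-forVertices Counted (λ _ inv → inv) (λ (frame , _) → proj₁ frame)
      (λ v s at-v (frame , counts) → runs-whenTop v s at-v (proj₁ (proj₂ frame)) (color-at {s} frame v) (s≤s z≤n)
        (λ cv≡k → runs-countNeighbours v s at-v cv≡k (frame , counts))
        (λ cv≢k → at-v , frame , λ i i<n → trans (counts i i<n) (sym (unchanged cv≢k i))))
      s (frame , λ i i<n → trans (zeros i i<n) (sym (sumBelow-zero (cutAt G c adj i))))
      where
      unchanged : ∀ {v} → toℕ (c v) ≢ k → ∀ i →
        sumBelow (cutAt G c adj i) (suc (toℕ v)) ≡ sumBelow (cutAt G c adj i) (toℕ v)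
      unchanged {v} cv≢k i = trans (sumBelow-suc (cutAt G c adj i) v)
        (trans (cong (λ b → sumBelow (cutAt G c adj i) (toℕ v) + 𝟙 b * sum (hit G c adj i v)) (≡ᵇ-false cv≢k)) (+-identityʳ _))

  Selected : ℕ → State → Set
  Selected m s = Frame s × (∀ i → i < n → arrs s countArr i ≡ cut G c adj i) × vars s bestVar < k ×
    (∀ i → i < m → i < k → arrs s countArr (vars s bestVar) ≤ arrs s countArr i)

  runs-select : ∀ s → Counted n s → Runs (bestVar ≔ lit 0 ⨾ forVertices improveBest) s (2 + (5 + n * 17)) (Selected n)
  runs-select s (frame , counts) = runs-seq {Q = Selected 0}
    -- Color 0 exists because `k` is positive, so `bestVar` holds a color below `k` even if the scan
    -- never changes it.
    (runs-assign (frame , (λ i i<n → trans (counts i i<n) (sumBelow-all (cutAt G c adj i))) , k>0 , λ _ ()))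
    (runs-forVertices Selected (λ _ inv → inv) (λ (frame , _) → proj₁ frame) improve)
    where
    improve : ∀ (v : Fin n) s → vars s vertexVar ≡ toℕ v → Selected (toℕ v) s →
      Runs improveBest s 10 (λ s′ → vars s′ vertexVar ≡ toℕ v × Selected (suc (toℕ v)) s′)
    improve v s at-v (frame , counts , best<k , best-min) = runs-cond
      (λ v<k → runs-cond
        (λ better → runs-assign (at-v , frame , counts , subst (vars s vertexVar <_) (proj₁ (proj₂ frame)) (<ᵇ-true⁻¹ v<k) ,
          extend (subst (λ x → arrs s countArr (vars s vertexVar) ≤ arrs s countArr x) at-v ≤-refl)
            λ i i<v i<k → ≤-trans (<⇒≤ (<ᵇ-true⁻¹ better)) (best-min i i<v i<k)))
        (λ worse → runs-weaken (s≤s z≤n) (runs-skip (at-v , frame , counts , best<k ,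
          extend (subst (λ x → arrs s countArr (vars s bestVar) ≤ arrs s countArr x) at-v (<ᵇ-false⁻¹ worse)) best-min))))
      -- From `k` on the index is not a color: `i < k ≤ v` leaves only the values of `i` that
      -- earlier rounds have treated.
      (λ v≮k → runs-weaken (s≤s z≤n) (runs-skip (at-v , frame , counts , best<k , λ i i≤v i<k →
        best-min i (≤∧≢⇒< (s≤s⁻¹ i≤v) λ i≡v → <-irrefl i≡v (<-≤-trans i<k
          (subst₂ _≤_ (proj₁ (proj₂ frame)) at-v (<ᵇ-false⁻¹ v≮k)))) i<k)))
      where
      extend : ∀ {a} → a ≤ arrs s countArr (toℕ v) → (∀ i → i < toℕ v → i < k → a ≤ arrs s countArr i) →
        ∀ i → i < suc (toℕ v) → i < k → a ≤ arrs s countArr i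
      extend a≤v a≤ i i≤v i<k with i ≟ toℕ v
      ... | yes refl = a≤v
      ... | no i≢v = a≤ i (≤∧≢⇒< (s≤s⁻¹ i≤v) i≢v) i<k

  module _ (b : ℕ) where

    -- Colors are overwritten in place, which destroys `Frame`. The unvisited vertices must still
    -- carry their original colors, as the coming tests read them.
    Recolored : ℕ → State → Set
    Recolored m s = vars s orderVar ≡ n × vars s colorsVar ≡ k × vars s bestVar ≡ b ×
      (∀ v → toℕ v < m → arrs s colorArr (toℕ v) ≡ merge k b (toℕ (c v))) ×
      (∀ v → m ≤ toℕ v → arrs s colorArr (toℕ v) ≡ toℕ (c v))

    runs-recolor : ∀ s → Frame s → vars s bestVar ≡ b →
      Runs (forVertices (whenTop recolor)) s (5 + n * 14) (Recolored n)
    runs-recolor s frame best≡b = runs-forVertices Recolored (λ _ inv → inv) proj₁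
      (λ v s at-v (order≡ , colors≡ , best≡ , done , todo) →
        runs-whenTop v s at-v colors≡ (todo v ≤-refl) (s≤s z≤n)
          (λ cv≡k → runs-store (at-v , order≡ , colors≡ , best≡ ,
            (λ u u≤v → done′ v s at-v best≡ cv≡k done u (s≤s⁻¹ u≤v)) ,
            (λ u v<u → trans (update-other (arrs s colorArr) (λ u≡ → <-irrefl (sym (trans u≡ at-v)) v<u)) (todo u (<⇒≤ v<u)))))
          (λ cv≢k → at-v , order≡ , colors≡ , best≡ , (λ u u≤v → keep v s done todo cv≢k u (s≤s⁻¹ u≤v)) , λ u v<u → todo u (<⇒≤ v<u)))
      s (proj₁ frame , proj₁ (proj₂ frame) , best≡b , (λ _ ()) , λ v _ → color-at {s} frame v)
      where
      done′ : ∀ v s → vars s vertexVar ≡ toℕ v → vars s bestVar ≡ b → toℕ (c v) ≡ k →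
        (∀ u → toℕ u < toℕ v → arrs s colorArr (toℕ u) ≡ merge k b (toℕ (c u))) →
        ∀ u → toℕ u ≤ toℕ v → update (arrs s colorArr) (vars s vertexVar) (vars s bestVar) (toℕ u) ≡ merge k b (toℕ (c u))
      done′ v s at-v best≡ cv≡k done u u≤v with u Fin.≟ v
      ... | yes refl = trans (update-same (arrs s colorArr) (sym at-v)) (trans best≡ (sym (merge-top k b cv≡k)))
      ... | no u≢v = trans (update-other (arrs s colorArr) (λ u≡ → u≢v (Fin.toℕ-injective (trans u≡ at-v))))
                           (done u (≤∧≢⇒< u≤v (u≢v ∘ Fin.toℕ-injective)))
      keep : ∀ v s →
        (∀ u → toℕ u < toℕ v → arrs s colorArr (toℕ u) ≡ merge k b (toℕ (c u))) →
        (∀ u → toℕ v ≤ toℕ u → arrs s colorArr (toℕ u) ≡ toℕ (c u)) → toℕ (c v) ≢ k →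
        ∀ u → toℕ u ≤ toℕ v → arrs s colorArr (toℕ u) ≡ merge k b (toℕ (c u))
      keep v s done todo cv≢k u u≤v with u Fin.≟ v
      ... | yes refl = trans (todo u ≤-refl) (sym (merge-other k b cv≢k))
      ... | no u≢v = done u (≤∧≢⇒< u≤v (u≢v ∘ Fin.toℕ-injective))

  -- Minimality is guarded by `k ≤ n`, since the selection reads no counter from `n` on and would
  -- otherwise miss some colors.
  Merged : State → Set
  Merged s = ∃[ b ] (b < k × (k ≤ n → ∀ i → i < k → cut G c adj b ≤ cut G c adj i) ×
    (∀ v → arrs s colorArr (toℕ v) ≡ merge k b (toℕ (c v))))

  runs-merge : ∀ {Δ} → (∀ v → length (adj v) ≤ Δ) → Runs mergeProgram s₀ (mergeCost n Δ) Merged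
  runs-merge length≤Δ =
    runs-seq runs-clear λ s₁ cleared →
    runs-seq (runs-count length≤Δ s₁ cleared) λ s₂ counted →
    reassoc (runs-seq (runs-select s₂ counted) λ s₃ (frame , counts , best<k , best-min) →
    finish best<k (λ k≤n i i<k → subst₂ _≤_ (counts _ (<-≤-trans best<k k≤n)) (counts i (<-≤-trans i<k k≤n))
                    (best-min i (<-≤-trans i<k k≤n) i<k))
      (runs-recolor (vars s₃ bestVar) s₃ frame refl))
    where
    -- Sequencing in `mergeProgram` associates to the right, while `runs-select` treats the
    -- initialization of `bestVar` and the scan as one block.
    reassoc : ∀ {P P′ P″ s T Q} → Runs ((P ⨾ P′) ⨾ P″) s T Q → Runs (P ⨾ P′ ⨾ P″) s T Q
    reassoc (s′ , _ , ⇓-seq (⇓-seq {t₁ = t₁} {t₂} run₁ run₂) run₃ , t≤ , q) =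
      s′ , _ , ⇓-seq run₁ (⇓-seq run₂ run₃) , ≤-trans (≤-reflexive (sym (+-assoc t₁ t₂ _))) t≤ , q
    finish : ∀ {P s T b} → b < k → (k ≤ n → ∀ i → i < k → cut G c adj b ≤ cut G c adj i) →
      Runs P s T (Recolored b n) → Runs P s T Merged
    finish {b = b} b<k min (s′ , t , run , t≤ , _ , _ , _ , done , _) =
      s′ , t , run , t≤ , b , b<k , min , λ v → done v (Fin.toℕ<n v)

-- The fractions in `ℚ` are reduced. Among unnormalised rationals the inequality is cross
-- multiplication, that is, the hypothesis.
a≤b/m : ∀ a b m .{{_ : NonZero m}} → a * m ≤ b → (ℤ.+ a ℚ./ 1) ℚ.≤ (ℤ.+ b ℚ./ m)
a≤b/m a b (suc d) am≤b = ℚ.toℚᵘ-cancel-≤ (begin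
  ℚ.toℚᵘ (ℤ.+ a ℚ./ 1)         ≃⟨ ℚ.toℚᵘ-fromℚᵘ (ℚᵘ.mkℚᵘ (ℤ.+ a) 0) ⟩
  ℚᵘ.mkℚᵘ (ℤ.+ a) 0            ≤⟨ ℚᵘ.*≤* (subst₂ ℤ._≤_ (ℤ.pos-* a (suc d)) (sym (ℤ.*-identityʳ (ℤ.+ b))) (ℤ.+≤+ am≤b)) ⟩
  ℚᵘ.mkℚᵘ (ℤ.+ b) d            ≃⟨ ℚ.toℚᵘ-fromℚᵘ (ℚᵘ.mkℚᵘ (ℤ.+ b) d) ⟨
  ℚ.toℚᵘ (ℤ.+ b ℚ./ suc d)     ∎)
  where open ℚᵘ.≤-Reasoning

-- From the selected cut to the bound on the penalty

module _ {n k : ℕ} (G : Graph n) (c : Coloring n (suc k)) (adj : Fin n → List (Fin n))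
  (unique : ∀ v → Unique (adj v)) (complete : ∀ {u v} → u ∈ˡ adj v ⇔ Graph._~_ G v u)
  (smallest : ∀ i → ∣ colorClass c (fromℕ k) ∣ ≤ ∣ colorClass c i ∣)
  {b : ℕ} (b<k : b < k) (b-min : k ≤ n → ∀ i → i < k → cut G c adj b ≤ cut G c adj i) where
  open ≤-Reasoning

  -- For `k ≤ n` the minimum is at most the average. For `k > n` the color `b` is arbitrary below
  -- `k`, but the last class is smaller than 1, so the sum of all cuts vanishes and with it the term
  -- of `b`.
  k*cut≤ : k * cut G c adj b ≤ tops G c adj * maxDegree G
  k*cut≤ with k ≤? n
  ... | yes k≤n = begin
    k * cut G c adj b                ≡⟨ sum-const k (cut G c adj b) ⟨
    ∑[ i < k ] cut G c adj b         ≤⟨ sum-mono-≤ (λ i → b-min k≤n (toℕ i) (Fin.toℕ<n i)) ⟩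
    ∑[ i < k ] cut G c adj (toℕ i)   ≤⟨ ∑-cut≤ G c adj unique complete ⟩
    tops G c adj * maxDegree G       ∎
  ... | no k≰n = begin
    k * cut G c adj b                ≡⟨ cong (k *_) (n≤0⇒n≡0 cut≤0) ⟩
    k * 0                            ≡⟨ *-zeroʳ k ⟩
    0                                ≤⟨ z≤n ⟩
    tops G c adj * maxDegree G       ∎
    where
    no-tops : tops G c adj ≡ 0
    no-tops = n<1⇒n≡0 (*-cancelˡ-< (suc k) (tops G c adj) 1 (begin-strict
      suc k * tops G c adj   ≤⟨ smallest-class-bound c smallest ⟩
      n                      <⟨ ≰⇒> k≰n ⟩
      k                      <⟨ n<1+n k ⟩
      suc k                  ≡⟨ *-identityʳ (suc k) ⟨
      suc k * 1              ∎))
    cut≤0 : cut G c adj b ≤ 0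
    cut≤0 = begin
      cut G c adj b                             ≡⟨ cong (cut G c adj) (Fin.toℕ-fromℕ< b<k) ⟨
      cut G c adj (toℕ (fromℕ< b<k))            ≤⟨ term≤sum (λ (i : Fin k) → cut G c adj (toℕ i)) (fromℕ< b<k) ⟩
      ∑[ i < k ] cut G c adj (toℕ i)            ≤⟨ ∑-cut≤ G c adj unique complete ⟩
      tops G c adj * maxDegree G                ≡⟨ cong (_* maxDegree G) no-tops ⟩
      0                                         ∎

  cut*k[k+1]≤ : cut G c adj b * (k * suc k) ≤ n * maxDegree G
  cut*k[k+1]≤ = begin
    cut G c adj b * (k * suc k)              ≡⟨ solve 3 (λ x k l → x :* (k :* l) := l :* (k :* x)) refl (cut G c adj b) k (suc k) ⟩
    suc k * (k * cut G c adj b)              ≤⟨ *-monoʳ-≤ (suc k) k*cut≤ ⟩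
    suc k * (tops G c adj * maxDegree G)     ≡⟨ *-assoc (suc k) (tops G c adj) (maxDegree G) ⟨
    suc k * tops G c adj * maxDegree G       ≤⟨ *-monoˡ-≤ (maxDegree G) (smallest-class-bound c smallest) ⟩
    n * maxDegree G                          ∎
    where open +-*-Solver

-- The product `ND` dominates 1, `n` and `n * Δ`, so the coefficients 22, 61 and 20 add up to 103.
-- The maxima with 1 absorb the constant and linear terms when `n` or `Δ` is 0.
mergeCost≤ : ∀ n Δ → mergeCost n Δ ≤ 103 * ((1 ⊔ n) * (1 ⊔ Δ))
mergeCost≤ n Δ = begin
  mergeCost n Δ                            ≡⟨ solve 2 (λ n Δ →
      (con 5 :+ n :* con 10) :+ ((con 5 :+ n :* (con 7 :+ (con 4 :+ (con 9 :+ Δ :* con 20)))) :+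
        ((con 2 :+ (con 5 :+ n :* con 17)) :+ (con 5 :+ n :* con 14)))
      := con 22 :+ (con 61 :* n :+ con 20 :* (n :* Δ))) refl n Δ ⟩
  22 + (61 * n + 20 * (n * Δ))             ≤⟨ +-mono-≤ (*-monoʳ-≤ 22 1≤ND) (+-mono-≤ (*-monoʳ-≤ 61 n≤ND) (*-monoʳ-≤ 20 nΔ≤ND)) ⟩
  22 * ND + (61 * ND + 20 * ND)            ≡⟨ solve 1 (λ x → con 22 :* x :+ (con 61 :* x :+ con 20 :* x) := con 103 :* x) refl ND ⟩
  103 * ND                                 ∎
  where
  open ≤-Reasoning
  open +-*-Solver
  ND : ℕ
  ND = (1 ⊔ n) * (1 ⊔ Δ)
  1≤ND : 1 ≤ ND
  1≤ND = *-mono-≤ (m≤m⊔n 1 n) (m≤m⊔n 1 Δ)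
  n≤ND : n ≤ ND
  n≤ND = subst (_≤ ND) (*-identityʳ n) (*-mono-≤ (m≤n⊔m 1 n) (m≤m⊔n 1 Δ))
  nΔ≤ND : n * Δ ≤ ND
  nΔ≤ND = *-mono-≤ (m≤n⊔m 1 n) (m≤n⊔m 1 Δ)

mergeColoring : ∀ {n k} (c : Coloring n (suc k)) {b} → b < k →
  ∃[ c′ ] (∀ v → toℕ {k} (c′ v) ≡ merge k b (toℕ (c v)))
mergeColoring {k = k} c {b} b<k = (λ v → fromℕ< (below v)) , λ v → Fin.toℕ-fromℕ< (below v)
  where
  below : ∀ v → merge k b (toℕ (c v)) < k
  below v with toℕ (c v) ≟ k
  ... | yes cv≡k = subst (_< k) (sym (merge-top k b cv≡k)) b<k
  ... | no cv≢k = subst (_< k) (sym (merge-other k b cv≢k)) (≤∧≢⇒< (s≤s⁻¹ (Fin.toℕ<n (c v))) cv≢k)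

open import Data.Integer using (+_)

proposition3 : ∃[ P ] ∃[ C ]
    (∀ {n : ℕ} (G : Graph n) (k : ℕ) .{{_ : NonZero k}} (c : Coloring n (suc k)) →
    Legal G c →
    (∀ (i : Fin (suc k)) → ∣ colorClass c (fromℕ k) ∣ ≤ ∣ colorClass c i ∣) →
    ∀ (s : State) → Input G c s →
    ∃[ s′ ] ∃[ t ]
    ( ⟨ P , s ⟩⇓⟨ s′ , t ⟩
    × t ≤ C * ((1 ⊔ n) * (1 ⊔ maxDegree G))
    × (∃[ c′ ]
    ( StoresColoring {n} {k} c′ s′
    × c′ ∈𝓡 c
    × (+ ρ G c′ ℚ./ 1) ℚ.≤ (ℚ._/_ (+ (n * maxDegree G)) (k * suc k) {{m*n≢0 k (suc k)}})))))
proposition3 = mergeProgram , 103 , λ {n} G k c legal smallest s input →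
  let open Input input
      s′ , t , run , t≤ , b , b<k , b-min , stored =
        -- The maximum degree enters the running time only as a bound on the lengths of the
        -- adjacency lists; the program never computes it.
        runs-merge c (>-nonZero⁻¹ k) s input (length-adj G c adj adj-unique adj-complete)
      c′ , merged = mergeColoring c b<k
      ρ≤ = ρ≤cut G c adj adj-unique adj-complete b c′ merged legal
  in s′ , t , run , ≤-trans t≤ (mergeCost≤ n (maxDegree G)) , c′ ,
     (λ v → trans (stored v) (sym (merged v))) ,
     merged∈𝓡 G c adj adj-unique adj-complete b c′ merged ,
     a≤b/m (ρ G c′) (n * maxDegree G) (k * suc k) {{m*n≢0 k (suc k)}}
       (≤-trans (*-monoˡ-≤ (k * suc k) ρ≤)
                (cut*k[k+1]≤ G c adj adj-unique adj-complete smallest b<k b-min))
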